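{- Let $r \ge 2$ and $n \ge 1$ be integers. Let $E_1, \ldots, E_{rn-r+1}$ be (not necessarily distinct) sets of edges of an $r$-partite hypergraph such that $\nu^*(E_i) \ge n$ for every $i = 1, \ldots, rn-r+1$. Then the family $E_1,\ldots,E_{rn-r+1}$ has a rainbow fractional matching of size $n$.
   Context: A hypergraph is $r$-partite if its vertex set has a partition $A_1,\ldots,A_r$ such that every edge consists of exactly one vertex from each $A_i$. For a set $E$ of edges, a fractional matching for $E$ is a function $f\colon E \to \mathbb{R}_{\ge 0}$ such that $\sum_{e \in E,\, e \ni v} f(e) \le 1$ for every vertex $v$; its size is $\sum_{e\in E} f(e)$. The fractional matching number $\nu^*(E)$ is the maximum size of a fractional matching for $E$. Given a family $E_1,\ldots,E_m$ of sets of edges, a rainbow fractional matching of size $n$ is a set of edges $\{e_1,\ldots,e_k\}$ with $e_j \in E_{\sigma(j)}$ for $j=1,\ldots,k$, where $\sigma(1),\ldots,\sigma(k)$ are distinct indices, together with a fractional matching $f\colon\{e_1,\ldots,e_k\}\to\mathbb{R}_{\ge 0}$ of size $n$.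
   Formalization: Fractional matchings, both in the hypothesis ν*(E_i) ≥ n and in the conclusion, take nonnegative rational instead of real weights (equivalent, since a linear program with rational data attains its maximum at a rational point). -}

module Defs where

open import Data.Nat using (ℕ; zero; suc; _≟_)
open import Data.Fin using (Fin; zero; suc)
open import Data.Vec using (Vec; lookup)
open import Data.List using (List; length)
import Data.List as List
open import Data.Integer using (+_)
open import Data.Rational using (ℚ; 0ℚ; 1ℚ; _+_; _≤_; _/_)
open import Data.Product using (Σ; ∃; _×_; _,_)
open import Data.Bool using (if_then_else_)
open import Relation.Nullary.Decidable using (⌊_⌋)
open import Relation.Binary.PropositionalEquality using (_≡_)
open import Function.Definitions using (Injective)

-- Vertices of an r-partite hypergraph: the vertex a ∈ ℕ of part i : Fin r,
-- i.e. the pair (i , a).  An edge picks exactly one vertex from each part,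
-- so it is a vector e : Vec ℕ r (e[i] is its vertex in part i).
Edge : ℕ → Set
Edge r = Vec ℕ r

EdgeSet : ℕ → Set
EdgeSet r = List (Edge r)

sumFin : (k : ℕ) → (Fin k → ℚ) → ℚ
sumFin zero    g = 0ℚ
sumFin (suc k) g = g zero + sumFin k (λ j → g (suc j))

ℕ→ℚ : ℕ → ℚ
ℕ→ℚ n = + n / 1

load : ∀ {r k} → (Fin k → Edge r) → (Fin k → ℚ) → Fin r → ℕ → ℚ
load {k = k} es f i a = sumFin k (λ j → if ⌊ lookup (es j) i ≟ a ⌋ then f j else 0ℚ)

IsFracMatching : ∀ {r k} → (Fin k → Edge r) → (Fin k → ℚ) → Set
IsFracMatching {r} {k} es f =
  ((j : Fin k) → 0ℚ ≤ f j) × ((i : Fin r) (a : ℕ) → load es f i a ≤ 1ℚ)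

size : ∀ {k} → (Fin k → ℚ) → ℚ
size {k} f = sumFin k f

-- ν*(E) ≥ n : some fractional matching of E has size ≥ n
-- (the maximum ν*(E) is attained, so this is equivalent).
νStar≥ : ∀ {r} → EdgeSet r → ℕ → Set
νStar≥ E n = Σ (Fin (length E) → ℚ) λ f →
  IsFracMatching (List.lookup E) f × (ℕ→ℚ n ≤ size f)

HasRainbowFracMatching : ∀ {r m} → (Fin m → EdgeSet r) → ℕ → Set
HasRainbowFracMatching {r} {m} E n =
  Σ ℕ λ k → Σ (Fin k → Fin m) λ σ → Σ (Fin k → Edge r) λ e →
  Σ (Fin k → ℚ) λ f →
    Injective _≡_ _≡_ σ ×
    ((j : Fin k) → Σ (Fin (length (E (σ j)))) λ p → List.lookup (E (σ j)) p ≡ e j) ×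
    IsFracMatching e f × (size f ≡ ℕ→ℚ n)

{-# OPTIONS --safe #-}
module Submission where

-- Fix M above all labels and put in ℚ^(1 + rM) the vector (1 , χ_e) of each edge e, the
-- unit vector of each vertex ("slack"), and the target (n , 1 , … , 1).  A set of edges
-- supports a fractional matching of size n iff the target lies in the cone of its edges
-- and the slack vectors.  Among all full transversals R of the sets Eᵢ choose one whose
-- cone is nearest to the target, and let z be the residual of the projection; z is
-- nonpositive on vertices.  If z₀ > 0, then the size of the fitted weights f is less than n.
-- Vertices without slack have load at least 1, so there are at most n - 1 of them in each
-- part, r(n - 1) in all.  The projection can be supported on linearly independent
-- generators, so some colour j has weight 0.  As νStar≥ (E j) n, some e ∈ E j
-- has z · (1 , χ_e) > 0, and replacing the j-th edge of R by e brings the cone strictly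
-- nearer: Bárány's argument for the colourful Carathéodory theorem.  Hence z₀ ≤ 0, and
-- then z · z = z · target ≤ 0, so z = 0.


open import Defs
open import Data.Bool using (if_then_else_; true; false)
open import Data.Fin
  using (Fin; zero; suc; _↑ˡ_; _↑ʳ_; combine; remQuot; toℕ; fromℕ<; splitAt; join)
open import Data.Fin.Properties
  using (all?; any?; ¬∀⟶∃¬; join-splitAt; remQuot-combine; combine-remQuot; toℕ-fromℕ<)
import Data.Fin.Properties as Fin
import Data.Integer as ℤ
import Data.Integer.Properties as ℤ
open import Data.List as List using (List; []; _∷_; length; map; _++_)
open import Data.List.Membership.Propositional using (_∈_)
open import Data.List.Membership.Propositional.Properties using (∈-lookup; ∈-++⁺ˡ; ∈-++⁺ʳ)
open import Data.List.Properties using (length-map; length-++)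
open import Data.List.Relation.Unary.All as All using (All; []; _∷_)
open import Data.List.Relation.Unary.All.Properties using (map⁻)
open import Data.List.Relation.Unary.Any as Any using (here; there)
open import Data.List.Relation.Unary.Any.Properties using (lookup-index)
open import Data.Maybe using (just; nothing)
open import Data.Nat as ℕ using (ℕ; zero; suc; s≤s)
import Data.Nat.Coprimality as Coprimality
import Data.Nat.Properties as ℕ
open import Data.Product using (∃; ∃₂; _×_; _,_; proj₁; proj₂)
open import Data.Sum using (_⊎_; inj₁; inj₂)
open import Data.Vec using (Vec; []; _∷_; lookup; _[_]≔_)
open import Data.Vec.Functional using () renaming (_∷_ to _∷ᶠ_; _++_ to _++ᶠ_)
open import Data.Vec.Functional.Properties using (lookup-++ˡ; lookup-++ʳ)
open import Data.Vec.Properties using (lookup∘update; lookup∘update′)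
open import Function using (_∘_; id)
open import Level using (0ℓ)
open import Relation.Binary.Bundles using (DecTotalOrder)
open import Relation.Binary.PropositionalEquality
open import Relation.Nullary using (¬_; yes; no; contradiction)
open import Relation.Nullary.Decidable using (⌊_⌋; isYes≗does; decidable-stable)
open import Relation.Unary using (Decidable)
open import Tactic.RingSolver using (solve-∀)
import Tactic.RingSolver.Core.AlmostCommutativeRing as ACR

-- Finite sums, inner products and unit vectors over ℚ.

module RationalVectors where
  open import Data.Rational hiding (floor)
  open import Data.Rational.Properties

  ringℚ : ACR.AlmostCommutativeRing 0ℓ 0ℓ
  ringℚ = ACR.fromCommutativeRing +-*-commutativeRing is0
    where
    is0 : ∀ x → _
    is0 x with 0ℚ ≟ x
    ... | yes p = just p
    ... | no _  = nothing

  ≤-from-diff : ∀ {p q d} → q ≡ p + d → 0ℚ ≤ d → p ≤ q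
  ≤-from-diff {p} {q} {d} eq 0≤d =
    subst₂ _≤_ (+-identityʳ p) (sym eq) (+-monoʳ-≤ p 0≤d)

  <⇒≱ : ∀ {p q} → p < q → q ≰ p
  <⇒≱ p<q q≤p = <-irrefl refl (<-≤-trans p<q q≤p)

  0≤- : ∀ {p q} → p ≤ q → 0ℚ ≤ q - p
  0≤- {p} {q} p≤q = subst (_≤ q - p) (+-inverseʳ p) (+-monoˡ-≤ (- p) p≤q)

  0≤neg : ∀ {p} → p ≤ 0ℚ → 0ℚ ≤ - p
  0≤neg p≤0 = neg-antimono-≤ p≤0

  0≤+ : ∀ {p q} → 0ℚ ≤ p → 0ℚ ≤ q → 0ℚ ≤ p + q
  0≤+ {p} {q} 0≤p 0≤q = subst (_≤ p + q) (+-identityʳ 0ℚ) (+-mono-≤ 0≤p 0≤q)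

  0≤* : ∀ {p q} → 0ℚ ≤ p → 0ℚ ≤ q → 0ℚ ≤ p * q
  0≤* {p} {q} 0≤p 0≤q = nonNegative⁻¹ (p * q)
    {{nonNeg*nonNeg⇒nonNeg p {{nonNegative 0≤p}} q {{nonNegative 0≤q}}}}

  *≤0 : ∀ {p q} → 0ℚ ≤ p → q ≤ 0ℚ → p * q ≤ 0ℚ
  *≤0 {p} {q} 0≤p q≤0 = nonPositive⁻¹ (p * q)
    {{nonNeg*nonPos⇒nonPos p {{nonNegative 0≤p}} q {{nonPositive q≤0}}}}

  0≤square : ∀ p → 0ℚ ≤ p * p
  0≤square p with ≤-total 0ℚ p
  ... | inj₁ 0≤p = 0≤* 0≤p 0≤p
  ... | inj₂ p≤0 = subst (0ℚ ≤_) (lemma p) (0≤* (0≤neg p≤0) (0≤neg p≤0))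
    where
    lemma : ∀ p → - p * - p ≡ p * p
    lemma = solve-∀ ringℚ

  *-cancelˡ-0 : ∀ {p q} → p ≢ 0ℚ → p * q ≡ 0ℚ → q ≡ 0ℚ
  *-cancelˡ-0 {p} {q} p≢0 pq≡0 = begin
    q              ≡⟨ *-identityˡ q ⟨
    1ℚ * q         ≡⟨ cong (_* q) (*-inverseˡ p) ⟨
    1/ p * p * q   ≡⟨ *-assoc (1/ p) p q ⟩
    1/ p * (p * q) ≡⟨ cong (1/ p *_) pq≡0 ⟩
    1/ p * 0ℚ      ≡⟨ *-zeroʳ (1/ p) ⟩
    0ℚ             ∎
    where
    open ≡-Reasoning
    instance _ = ≢-nonZero p≢0

  square≡0 : ∀ {p} → p * p ≡ 0ℚ → p ≡ 0ℚ
  square≡0 {p} pp≡0 with p ≟ 0ℚ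
  ... | yes p≡0 = p≡0
  ... | no  p≢0 = *-cancelˡ-0 p≢0 pp≡0

  Σ-cong : ∀ {k} {g h : Fin k → ℚ} → (∀ j → g j ≡ h j) → sumFin k g ≡ sumFin k h
  Σ-cong {zero}  eq = refl
  Σ-cong {suc k} eq = cong₂ _+_ (eq zero) (Σ-cong (eq ∘ suc))

  Σ-0 : ∀ {k} {g : Fin k → ℚ} → (∀ j → g j ≡ 0ℚ) → sumFin k g ≡ 0ℚ
  Σ-0 {zero}  eq = refl
  Σ-0 {suc k} eq = trans (cong₂ _+_ (eq zero) (Σ-0 (eq ∘ suc))) (+-identityʳ 0ℚ)

  Σ-+ : ∀ {k} (g h : Fin k → ℚ) → sumFin k (λ j → g j + h j) ≡ sumFin k g + sumFin k h
  Σ-+ {zero}  g h = refl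
  Σ-+ {suc k} g h = trans (cong (g zero + h zero +_) (Σ-+ (g ∘ suc) (h ∘ suc))) (lemma (g zero) (h zero) _ _)
    where
    lemma : ∀ a b c d → a + b + (c + d) ≡ a + c + (b + d)
    lemma = solve-∀ ringℚ

  Σ-* : ∀ {k} c (g : Fin k → ℚ) → sumFin k (λ j → c * g j) ≡ c * sumFin k g
  Σ-* {zero}  c g = sym (*-zeroʳ c)
  Σ-* {suc k} c g = trans (cong (c * g zero +_) (Σ-* c (g ∘ suc))) (sym (*-distribˡ-+ c (g zero) _))

  Σ-- : ∀ {k} (g h : Fin k → ℚ) → sumFin k (λ j → g j - h j) ≡ sumFin k g - sumFin k h
  Σ-- {zero}  g h = refl
  Σ-- {suc k} g h = trans (cong (g zero - h zero +_) (Σ-- (g ∘ suc) (h ∘ suc))) (lemma (g zero) (h zero) _ _)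
    where
    lemma : ∀ a b c d → a - b + (c - d) ≡ a + c - (b + d)
    lemma = solve-∀ ringℚ

  Σ-comm : ∀ {k l} (g : Fin k → Fin l → ℚ) →
           sumFin k (λ i → sumFin l (g i)) ≡ sumFin l (λ j → sumFin k (λ i → g i j))
  Σ-comm {zero}  {l} g = sym (Σ-0 {l} (λ _ → refl))
  Σ-comm {suc k} {l} g = trans (cong (sumFin l (g zero) +_) (Σ-comm (g ∘ suc))) (sym (Σ-+ (g zero) _))

  Σ-mono : ∀ {k} {g h : Fin k → ℚ} → (∀ j → g j ≤ h j) → sumFin k g ≤ sumFin k h
  Σ-mono {zero}  g≤h = ≤-refl
  Σ-mono {suc k} g≤h = +-mono-≤ (g≤h zero) (Σ-mono (g≤h ∘ suc))

  Σ-≤0 : ∀ {k} {g : Fin k → ℚ} → (∀ j → g j ≤ 0ℚ) → sumFin k g ≤ 0ℚ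
  Σ-≤0 {k} g≤0 = subst (sumFin k _ ≤_) (Σ-0 {k} (λ _ → refl)) (Σ-mono g≤0)

  Σ-≥0 : ∀ {k} {g : Fin k → ℚ} → (∀ j → 0ℚ ≤ g j) → 0ℚ ≤ sumFin k g
  Σ-≥0 {k} 0≤g = subst (_≤ sumFin k _) (Σ-0 {k} (λ _ → refl)) (Σ-mono 0≤g)

  0≤⇒sum≤0⇒≡0 : ∀ {k} {g : Fin k → ℚ} → (∀ j → 0ℚ ≤ g j) → sumFin k g ≤ 0ℚ → ∀ j → g j ≡ 0ℚ
  0≤⇒sum≤0⇒≡0 {suc k} {g} 0≤g Σ≤0 zero = ≤-antisym
    (≤-trans (≤-from-diff refl (Σ-≥0 (0≤g ∘ suc))) Σ≤0) (0≤g zero)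
  0≤⇒sum≤0⇒≡0 {suc k} {g} 0≤g Σ≤0 (suc j) = 0≤⇒sum≤0⇒≡0 (0≤g ∘ suc)
    (≤-trans (≤-from-diff (+-comm (g zero) _) (0≤g zero)) Σ≤0) j

  Vector : ℕ → Set
  Vector N = Fin N → ℚ

  _⊖_ : ∀ {N} → Vector N → Vector N → Vector N
  (u ⊖ v) x = u x - v x

  infixl 7 _·_
  _·_ : ∀ {N} → Vector N → Vector N → ℚ
  u · v = sumFin _ (λ x → u x * v x)

  comb : ∀ {N k} → (Fin k → Vector N) → (Fin k → ℚ) → Vector N
  comb as f x = sumFin _ (λ j → f j * as j x)

  ·-congʳ : ∀ {N} (u : Vector N) {v w : Vector N} → (∀ x → v x ≡ w x) → u · v ≡ u · w
  ·-congʳ u eq = Σ-cong (λ x → cong (u x *_) (eq x))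

  ·-comm : ∀ {N} (u v : Vector N) → u · v ≡ v · u
  ·-comm u v = Σ-cong (λ x → *-comm (u x) (v x))

  ·-sub : ∀ {N} (u v w : Vector N) c → u · (λ x → v x - c * w x) ≡ u · v - c * (u · w)
  ·-sub u v w c = begin
    u · (λ x → v x - c * w x)                    ≡⟨ Σ-cong (λ x → lemma (u x) (v x) (w x) c) ⟩
    sumFin _ (λ x → u x * v x - c * (u x * w x)) ≡⟨ Σ-- (λ x → u x * v x) (λ x → c * (u x * w x)) ⟩
    u · v - sumFin _ (λ x → c * (u x * w x))     ≡⟨ cong (λ q → u · v - q) (Σ-* c (λ x → u x * w x)) ⟩
    u · v - c * (u · w)                          ∎
    where
    open ≡-Reasoning
    lemma : ∀ u v w c → u * (v - c * w) ≡ u * v - c * (u * w)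
    lemma = solve-∀ ringℚ

  ·-+ : ∀ {N} (u v w : Vector N) → u · (λ x → v x + w x) ≡ u · v + u · w
  ·-+ u v w = trans (Σ-cong (λ x → *-distribˡ-+ (u x) (v x) (w x)))
                    (Σ-+ (λ x → u x * v x) (λ x → u x * w x))

  ·-comb : ∀ {N k} (u : Vector N) (as : Fin k → Vector N) f →
           u · comb as f ≡ sumFin k (λ j → f j * (u · as j))
  ·-comb {N} {k} u as f = begin
    sumFin N (λ x → u x * sumFin k (λ j → f j * as j x))
      ≡⟨ Σ-cong (λ x → sym (Σ-* (u x) (λ j → f j * as j x))) ⟩
    sumFin N (λ x → sumFin k (λ j → u x * (f j * as j x)))
      ≡⟨ Σ-comm (λ x j → u x * (f j * as j x)) ⟩
    sumFin k (λ j → sumFin N (λ x → u x * (f j * as j x)))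
      ≡⟨ Σ-cong (λ j → trans (Σ-cong (λ x → lemma (u x) (f j) (as j x)))
                              (Σ-* (f j) (λ x → u x * as j x))) ⟩
    sumFin k (λ j → f j * (u · as j)) ∎
    where
    open ≡-Reasoning
    lemma : ∀ u f a → u * (f * a) ≡ f * (u * a)
    lemma = solve-∀ ringℚ

  0≤·-self : ∀ {N} (u : Vector N) → 0ℚ ≤ u · u
  0≤·-self u = Σ-≥0 (λ x → 0≤square (u x))

  ·-definite : ∀ {N} (u : Vector N) → u · u ≤ 0ℚ → ∀ x → u x ≡ 0ℚ
  ·-definite u uu≤0 x = square≡0 (0≤⇒sum≤0⇒≡0 (λ x → 0≤square (u x)) uu≤0 x)

  0-· : ∀ {N} {u : Vector N} (v : Vector N) → (∀ x → u x ≡ 0ℚ) → u · v ≡ 0ℚ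
  0-· v eq = Σ-0 (λ x → trans (cong (_* v x) (eq x)) (*-zeroˡ (v x)))

  -- Both pairs decompose the same vector, so z - z′ = p′ - p and one factor of the square can be
  -- replaced. In this form, with residuals z, z′ and projections p, p′, complementarity removes z ·
  -- p and z′ · p′, and duality bounds the mixed products.
  ∥⊖∥² : ∀ {N} (z p z′ p′ : Vector N) → (∀ x → z x + p x ≡ z′ x + p′ x) →
         (z ⊖ z′) · (z ⊖ z′) ≡ z · p′ - z · p - (z′ · p′ - z′ · p)
  ∥⊖∥² z p z′ p′ eq = begin
    (z ⊖ z′) · (z ⊖ z′)
      ≡⟨ Σ-cong (λ x → pointwise (z x) (p x) (z′ x) (p′ x) (eq x)) ⟩
    sumFin _ (λ x → z x * p′ x - z x * p x - (z′ x * p′ x - z′ x * p x))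
      ≡⟨ Σ-- (λ x → z x * p′ x - z x * p x) (λ x → z′ x * p′ x - z′ x * p x) ⟩
    sumFin _ (λ x → z x * p′ x - z x * p x) - sumFin _ (λ x → z′ x * p′ x - z′ x * p x)
      ≡⟨ cong₂ _-_ (Σ-- (λ x → z x * p′ x) (λ x → z x * p x))
                   (Σ-- (λ x → z′ x * p′ x) (λ x → z′ x * p x)) ⟩
    z · p′ - z · p - (z′ · p′ - z′ · p) ∎
    where
    open ≡-Reasoning
    lemma₁ : ∀ z p z′ → (z - z′) * (z - z′) ≡ (z - z′) * (z + p - z′ - p)
    lemma₁ = solve-∀ ringℚ
    lemma₂ : ∀ z p z′ p′ → (z - z′) * (z′ + p′ - z′ - p) ≡ z * p′ - z * p - (z′ * p′ - z′ * p)
    lemma₂ = solve-∀ ringℚ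
    pointwise : ∀ z p z′ p′ → z + p ≡ z′ + p′ →
                (z - z′) * (z - z′) ≡ z * p′ - z * p - (z′ * p′ - z′ * p)
    pointwise z p z′ p′ eq = trans (lemma₁ z p z′)
      (trans (cong (λ q → (z - z′) * (q - z′ - p)) eq) (lemma₂ z p z′ p′))

  Σ-↑ : ∀ p {q} (g : Fin (p ℕ.+ q) → ℚ) →
        sumFin (p ℕ.+ q) g ≡ sumFin p (λ i → g (i ↑ˡ q)) + sumFin q (λ j → g (p ↑ʳ j))
  Σ-↑ zero    g = sym (+-identityˡ _)
  Σ-↑ (suc p) g = trans (cong (g zero +_) (Σ-↑ p (g ∘ suc))) (sym (+-assoc (g zero) _ _))

  ↑-elim : ∀ {p q} {P : Fin (p ℕ.+ q) → Set} →
           (∀ i → P (i ↑ˡ q)) → (∀ j → P (p ↑ʳ j)) → ∀ x → P x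
  ↑-elim {p} {q} {P} left right x = subst P (join-splitAt p q x) (go (splitAt p x))
    where
    go : ∀ y → P (join p q y)
    go (inj₁ i) = left i
    go (inj₂ j) = right j

  δ : ∀ {k} → Fin k → Fin k → ℚ
  δ zero    zero    = 1ℚ
  δ zero    (suc w) = 0ℚ
  δ (suc v) zero    = 0ℚ
  δ (suc v) (suc w) = δ v w

  δ-sym : ∀ {k} (v w : Fin k) → δ v w ≡ δ w v
  δ-sym zero    zero    = refl
  δ-sym zero    (suc w) = refl
  δ-sym (suc v) zero    = refl
  δ-sym (suc v) (suc w) = δ-sym v w

  Σ-δ : ∀ {k} (g : Fin k → ℚ) w → sumFin k (λ v → g v * δ v w) ≡ g w
  Σ-δ g zero    = trans (cong₂ _+_ (*-identityʳ (g zero)) (Σ-0 (λ v → *-zeroʳ (g (suc v)))))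
                        (+-identityʳ (g zero))
  Σ-δ g (suc w) = trans (cong₂ _+_ (*-zeroʳ (g zero)) (Σ-δ (g ∘ suc) w)) (+-identityˡ (g (suc w)))

  Σ-indicator : ∀ {M} l → l ℕ.< M → sumFin M (λ a → if ⌊ l ℕ.≟ toℕ a ⌋ then 1ℚ else 0ℚ) ≡ 1ℚ
  Σ-indicator {suc M} zero    _         = trans (cong (1ℚ +_) (Σ-0 {M} (λ _ → refl))) (+-identityʳ 1ℚ)
  Σ-indicator {suc M} (suc l) (s≤s l<M) = trans (+-identityˡ (sumFin M _))
    (trans (Σ-cong {M} (λ a → cong (if_then 1ℚ else 0ℚ) (⌊suc≟suc⌋ l (toℕ a)))) (Σ-indicator l l<M))
    where
    ⌊suc≟suc⌋ : ∀ a b → ⌊ suc a ℕ.≟ suc b ⌋ ≡ ⌊ a ℕ.≟ b ⌋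
    ⌊suc≟suc⌋ a b = trans (isYes≗does (suc a ℕ.≟ suc b)) (sym (isYes≗does (a ℕ.≟ b)))

open RationalVectors

-- Nearest points of finitely generated cones.

module ConicProjection where
  open import Data.Rational hiding (floor)
  open import Data.Rational.Properties

  -- The Karush-Kuhn-Tucker conditions for the point of the cone of `as` nearest to `b`; they avoid
  -- any appeal to compactness or square roots. The field `independent` adds Carathéodory's
  -- condition: the generators of nonzero weight are linearly independent.
  record Projection {N k} (as : Fin k → Vector N) (b : Vector N) : Set where
    field
      coeff         : Fin k → ℚ
      residual      : Vector N
      0≤coeff       : ∀ j → 0ℚ ≤ coeff j
      decomposition : ∀ x → b x ≡ residual x + comb as coeff x
      dual          : ∀ j → residual · as j ≤ 0ℚ
      complementary : ∀ j → coeff j * (residual · as j) ≡ 0ℚ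
      independent   : ∀ g → (∀ j → coeff j ≡ 0ℚ → g j ≡ 0ℚ) →
                      (∀ x → comb as g x ≡ 0ℚ) → ∀ j → g j ≡ 0ℚ

    residual·comb≤0 : ∀ f → (∀ j → 0ℚ ≤ f j) → residual · comb as f ≤ 0ℚ
    residual·comb≤0 f 0≤f = subst (_≤ 0ℚ) (sym (·-comb residual as f))
      (Σ-≤0 (λ j → *≤0 (0≤f j) (dual j)))

    residual·projection : residual · comb as coeff ≡ 0ℚ
    residual·projection = trans (·-comb residual as coeff) (Σ-0 complementary)

    ·target : ∀ u → u · b ≡ u · residual + u · comb as coeff
    ·target u = trans (·-congʳ u decomposition) (·-+ u residual (comb as coeff))

    residual·target : residual · b ≡ residual · residual
    residual·target = trans (·target residual)
      (trans (cong (residual · residual +_) residual·projection) (+-identityʳ _))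

  open Projection

  -- If the first projection lies in the second cone, then |z|² ≥ |z′|² + |z - z′|².
  closest-residual-unique : ∀ {N k l} {as : Fin k → Vector N} {as′ : Fin l → Vector N} {b}
    (A : Projection as b) (B : Projection as′ b) →
    ∀ c → (∀ j → 0ℚ ≤ c j) → (∀ x → comb as′ c x ≡ comb as (coeff A) x) →
    residual A · residual A ≤ residual B · residual B → ∀ x → residual A x ≡ residual B x
  closest-residual-unique {as = as} {as′} {b} A B c 0≤c common zz≤z′z′ x = begin
    z x               ≡⟨ lemma₁ (z x) (z′ x) ⟩
    z′ x + (z ⊖ z′) x ≡⟨ cong (z′ x +_) (·-definite (z ⊖ z′) ∥z-z′∥²≤0 x) ⟩
    z′ x + 0ℚ         ≡⟨ +-identityʳ (z′ x) ⟩
    z′ x              ∎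
    where
    open ≡-Reasoning
    z z′ p p′ : Vector _
    z  = residual A
    z′ = residual B
    p  = comb as (coeff A)
    p′ = comb as′ (coeff B)

    lemma₁ : ∀ a b → a ≡ b + (a - b)
    lemma₁ = solve-∀ ringℚ

    lemma₂ : ∀ zz z′z′ zz′ zp′ z′p →
      0ℚ ≡ zp′ - 0ℚ - (0ℚ - z′p) + (z′z′ - zz + (- z′p + - z′p)) + ((zz - (zz′ + zp′)) - (z′z′ - (zz′ + z′p)))
    lemma₂ = solve-∀ ringℚ

    lemma₃ : ∀ a b → a ≡ b → a - b ≡ 0ℚ
    lemma₃ a b refl = +-inverseʳ a

    z′p≤0 : z′ · p ≤ 0ℚ
    z′p≤0 = subst (_≤ 0ℚ) (·-congʳ z′ common) (residual·comb≤0 B c 0≤c)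

    zz : z · z ≡ z · z′ + z · p′
    zz = trans (sym (residual·target A)) (·target B z)

    z′z′ : z′ · z′ ≡ z · z′ + z′ · p
    z′z′ = trans (sym (residual·target B)) (trans (·target A z′) (cong (_+ z′ · p) (·-comm z′ z)))

    distance : (z ⊖ z′) · (z ⊖ z′) ≡ z · p′ - 0ℚ - (0ℚ - z′ · p)
    distance = trans
      (∥⊖∥² z p z′ p′ (λ x → trans (sym (decomposition A x)) (decomposition B x)))
      (cong₂ (λ s t → z · p′ - s - (t - z′ · p)) (residual·projection A) (residual·projection B))

    gap : ℚ
    gap = z′ · z′ - z · z + (- (z′ · p) + - (z′ · p))

    -- By `distance`, |z - z′|² = z · p′ + z′ · p, while `zz` minus `z′z′` gives z · z - z′ · z′ = z
    -- · p′ - z′ · p. Hence |z - z′|² + `gap` = 0, and both summands of `gap` are nonnegative.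
    ∥z-z′∥²≤0 : (z ⊖ z′) · (z ⊖ z′) ≤ 0ℚ
    ∥z-z′∥²≤0 = ≤-from-diff (begin
        0ℚ
          ≡⟨ lemma₂ (z · z) (z′ · z′) (z · z′) (z · p′) (z′ · p) ⟩
        z · p′ - 0ℚ - (0ℚ - z′ · p) + gap + ((z · z - (z · z′ + z · p′)) - (z′ · z′ - (z · z′ + z′ · p)))
          ≡⟨ cong₂ (λ s t → z · p′ - 0ℚ - (0ℚ - z′ · p) + gap + (s - t)) (lemma₃ _ _ zz) (lemma₃ _ _ z′z′) ⟩
        z · p′ - 0ℚ - (0ℚ - z′ · p) + gap + (0ℚ - 0ℚ)
          ≡⟨ +-identityʳ _ ⟩
        z · p′ - 0ℚ - (0ℚ - z′ · p) + gap
          ≡⟨ cong (_+ gap) (sym distance) ⟩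
        (z ⊖ z′) · (z ⊖ z′) + gap ∎)
      (0≤+ (0≤- zz≤z′z′) (0≤+ (0≤neg z′p≤0) (0≤neg z′p≤0)))

  -- Since the projection on the other generators leaves a residual z₀ with z₀ · a₀ > 0, a₀ is
  -- active: project orthogonally to a₀.  Its weight s is ≥ 0 because s (z₀ · a₀) ≥ |z₀ - z|².
  module Exchange {N k} (as : Fin (suc k) → Vector N) (b : Vector N)
    (old : Projection (as ∘ suc) b) (0<ζ : 0ℚ < residual old · as zero)
    (project : ∀ as′ b′ → Projection {N} {k} as′ b′) where

    open ≡-Reasoning

    a₀ : Vector N
    a₀ = as zero

    ζ q : ℚ
    ζ = residual old · a₀
    q = a₀ · a₀

    q≢0 : q ≢ 0ℚ
    q≢0 q≡0 = <-irrefl (sym ζ≡0) 0<ζ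
      where
      ζ≡0 : ζ ≡ 0ℚ
      ζ≡0 = trans (·-comm (residual old) a₀)
        (0-· (residual old) (·-definite a₀ (≤-reflexive q≡0)))

    instance _ = ≢-nonZero q≢0

    along : Vector N → ℚ
    along v = a₀ · v * 1/ q

    perp : Vector N → Vector N
    perp v x = v x - along v * a₀ x

    a₀·perp : ∀ v → a₀ · perp v ≡ 0ℚ
    a₀·perp v = begin
      a₀ · perp v                     ≡⟨ ·-sub a₀ v a₀ (along v) ⟩
      a₀ · v - a₀ · v * 1/ q * q      ≡⟨ cong (λ t → a₀ · v - t) (*-assoc (a₀ · v) (1/ q) q) ⟩
      a₀ · v - a₀ · v * (1/ q * q)    ≡⟨ cong (λ t → a₀ · v - a₀ · v * t) (*-inverseˡ q) ⟩
      a₀ · v - a₀ · v * 1ℚ            ≡⟨ lemma (a₀ · v) ⟩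
      0ℚ                              ∎
      where
      lemma : ∀ t → t - t * 1ℚ ≡ 0ℚ
      lemma = solve-∀ ringℚ

    Σalong : (Fin k → ℚ) → ℚ
    Σalong g = sumFin k (λ j → g j * along (as (suc j)))

    perps : Fin k → Vector N
    perps j = perp (as (suc j))

    comb-perps : ∀ g x → comb perps g x ≡ comb (as ∘ suc) g x - Σalong g * a₀ x
    comb-perps g x = begin
      sumFin k (λ j → g j * perp (as (suc j)) x)
        ≡⟨ Σ-cong (λ j → lemma (g j) (as (suc j) x) (along (as (suc j))) (a₀ x)) ⟩
      sumFin k (λ j → g j * as (suc j) x - a₀ x * (g j * along (as (suc j))))
        ≡⟨ Σ-- (λ j → g j * as (suc j) x) (λ j → a₀ x * (g j * along (as (suc j)))) ⟩
      comb (as ∘ suc) g x - sumFin k (λ j → a₀ x * (g j * along (as (suc j))))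
        ≡⟨ cong (λ t → comb (as ∘ suc) g x - t)
             (trans (Σ-* (a₀ x) (λ j → g j * along (as (suc j)))) (*-comm (a₀ x) (Σalong g))) ⟩
      comb (as ∘ suc) g x - Σalong g * a₀ x ∎
      where
      lemma : ∀ g a α x → g * (a - α * x) ≡ g * a - x * (g * α)
      lemma = solve-∀ ringℚ

    a₀·comb-perps : ∀ g → a₀ · comb perps g ≡ 0ℚ
    a₀·comb-perps g = trans (·-comb a₀ perps g)
      (Σ-0 (λ j → trans (cong (g j *_) (a₀·perp (as (suc j)))) (*-zeroʳ (g j))))

    -- The vectors and the target differ from those of `old`, but there are only `k` generators, so
    -- the induction is on their number, over all families at once.
    new : Projection perps (perp b)
    new = project perps (perp b)

    z = residual new
    f = coeff new

    -- Collects the multiples of `a₀` that were split off from `b` and from the weighted generators.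
    s : ℚ
    s = along b - Σalong f

    z·a₀ : z · a₀ ≡ 0ℚ
    z·a₀ = begin
      z · a₀                             ≡⟨ ·-comm z a₀ ⟩
      a₀ · z                             ≡⟨ +-identityʳ (a₀ · z) ⟨
      a₀ · z + 0ℚ                        ≡⟨ cong (a₀ · z +_) (a₀·comb-perps f) ⟨
      a₀ · z + a₀ · comb perps f         ≡⟨ ·-+ a₀ z (comb perps f) ⟨
      a₀ · (λ x → z x + comb perps f x)  ≡⟨ ·-congʳ a₀ (decomposition new) ⟨
      a₀ · perp b                        ≡⟨ a₀·perp b ⟩
      0ℚ                                 ∎

    -- Since `z` is orthogonal to `a₀`, the dual and complementary conditions for `perps` carry over
    -- to the original generators, and those at `a₀` hold whatever the sign of `s`.
    z·perp : ∀ v → z · perp v ≡ z · v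
    z·perp v = begin
      z · perp v                   ≡⟨ ·-sub z v a₀ (along v) ⟩
      z · v - along v * (z · a₀)   ≡⟨ cong (λ t → z · v - along v * t) z·a₀ ⟩
      z · v - along v * 0ℚ         ≡⟨ lemma (z · v) (along v) ⟩
      z · v                        ∎
      where
      lemma : ∀ t c → t - c * 0ℚ ≡ t
      lemma = solve-∀ ringℚ

    decomp : ∀ x → b x ≡ z x + comb as (s ∷ᶠ f) x
    decomp x = begin
      b x
        ≡⟨ lemma₁ (b x) (along b * a₀ x) ⟩
      perp b x + along b * a₀ x
        ≡⟨ cong (_+ along b * a₀ x) (decomposition new x) ⟩
      z x + comb perps f x + along b * a₀ x
        ≡⟨ cong (λ t → z x + t + along b * a₀ x) (comb-perps f x) ⟩
      z x + (comb (as ∘ suc) f x - Σalong f * a₀ x) + along b * a₀ x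
        ≡⟨ lemma₂ (z x) (comb (as ∘ suc) f x) (Σalong f) (a₀ x) (along b) ⟩
      z x + (s * a₀ x + comb (as ∘ suc) f x) ∎
      where
      lemma₁ : ∀ b c → b ≡ b - c + c
      lemma₁ = solve-∀ ringℚ
      lemma₂ : ∀ z c σ a β → z + (c - σ * a) + β * a ≡ z + ((β - σ) * a + c)
      lemma₂ = solve-∀ ringℚ

    dual′ : ∀ j → z · as j ≤ 0ℚ
    dual′ zero    = ≤-reflexive z·a₀
    dual′ (suc j) = subst (_≤ 0ℚ) (z·perp (as (suc j))) (dual new j)

    complementary′ : ∀ j → (s ∷ᶠ f) j * (z · as j) ≡ 0ℚ
    complementary′ zero    = trans (cong (s *_) z·a₀) (*-zeroʳ s)
    complementary′ (suc j) =
      trans (cong (f j *_) (sym (z·perp (as (suc j))))) (complementary new j)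

    -- Comparing the two decompositions of `b` by `∥⊖∥²` gives |z₀ - z|² = s ζ + z₀ · p + z · p₀.
    -- The last two terms are nonpositive: each pairs a residual with a nonnegative combination of
    -- generators on which it is nonpositive.
    0≤sζ : 0ℚ ≤ s * ζ
    0≤sζ = ≤-trans (0≤·-self (z₀ ⊖ z)) (≤-from-diff sζ≡ (0≤+ (0≤neg z₀p≤0) (0≤neg zp₀≤0)))
      where
      z₀ p₀ p : Vector N
      z₀ = residual old
      p₀ = comb (as ∘ suc) (coeff old)
      p  = comb (as ∘ suc) f

      z₀p≤0 : z₀ · p ≤ 0ℚ
      z₀p≤0 = residual·comb≤0 old f (0≤coeff new)

      zp₀≤0 : z · p₀ ≤ 0ℚ
      zp₀≤0 = subst (_≤ 0ℚ) (sym (·-comb z (as ∘ suc) (coeff old)))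
        (Σ-≤0 (λ j → *≤0 (0≤coeff old j) (dual′ (suc j))))

      zp≡0 : z · comb as (s ∷ᶠ f) ≡ 0ℚ
      zp≡0 = trans (·-comb z as (s ∷ᶠ f)) (Σ-0 complementary′)

      z₀·full : z₀ · comb as (s ∷ᶠ f) ≡ s * ζ + z₀ · p
      z₀·full = begin
        z₀ · comb as (s ∷ᶠ f) ≡⟨ ·-comb z₀ as (s ∷ᶠ f) ⟩
        s * ζ + sumFin k (λ j → f j * (z₀ · as (suc j)))
          ≡⟨ cong (s * ζ +_) (sym (·-comb z₀ (as ∘ suc) f)) ⟩
        s * ζ + z₀ · p ∎

      lemma : ∀ A B C → A ≡ A + B - 0ℚ - (0ℚ - C) + (- B + - C)
      lemma = solve-∀ ringℚ

      sζ≡ : s * ζ ≡ (z₀ ⊖ z) · (z₀ ⊖ z) + (- (z₀ · p) + - (z · p₀))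
      sζ≡ = begin
        s * ζ
          ≡⟨ lemma (s * ζ) (z₀ · p) (z · p₀) ⟩
        s * ζ + z₀ · p - 0ℚ - (0ℚ - z · p₀) + (- (z₀ · p) + - (z · p₀))
          ≡⟨ cong (_+ (- (z₀ · p) + - (z · p₀))) (sym (trans
               (∥⊖∥² z₀ p₀ z (comb as (s ∷ᶠ f)) (λ x → trans (sym (decomposition old x)) (decomp x)))
               (cong₂ _-_ (cong₂ _-_ z₀·full (residual·projection old))
                          (cong (_- z · p₀) zp≡0)))) ⟩
        (z₀ ⊖ z) · (z₀ ⊖ z) + (- (z₀ · p) + - (z · p₀)) ∎

    0≤s : 0ℚ ≤ s
    0≤s = *-cancelʳ-≤-pos ζ {{positive 0<ζ}} (subst (_≤ s * ζ) (sym (*-zeroˡ ζ)) 0≤sζ)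

    -- Removing the `a₀` components from a dependence gives `comb perps gs` = -γ a₀. The left side
    -- is orthogonal to `a₀`, so γ = 0. Independence for `new` then kills `gs`, and γ = 0 leaves
    -- `g zero` = 0.
    independent′ : ∀ g → (∀ j → (s ∷ᶠ f) j ≡ 0ℚ → g j ≡ 0ℚ) →
                   (∀ x → comb as g x ≡ 0ℚ) → ∀ j → g j ≡ 0ℚ
    independent′ g supp g-dep = λ where
        zero    → g₀≡0
        (suc j) → gs≡0 j
      where
      gs : Fin k → ℚ
      gs = g ∘ suc

      γ : ℚ
      γ = g zero + Σalong gs

      comb-perps≡ : ∀ x → comb perps gs x ≡ 0ℚ - γ * a₀ x
      comb-perps≡ x = begin
        comb perps gs x                            ≡⟨ comb-perps gs x ⟩
        comb (as ∘ suc) gs x - Σalong gs * a₀ x    ≡⟨ lemma (comb (as ∘ suc) gs x) (Σalong gs) (a₀ x) (g zero) ⟩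
        comb as g x - γ * a₀ x                     ≡⟨ cong (_- γ * a₀ x) (g-dep x) ⟩
        0ℚ - γ * a₀ x                              ∎
        where
        lemma : ∀ c σ a g → c - σ * a ≡ g * a + c - (g + σ) * a
        lemma = solve-∀ ringℚ

      qγ≡0 : q * γ ≡ 0ℚ
      qγ≡0 = begin
        q * γ                                     ≡⟨ lemma q γ (a₀ · (λ _ → 0ℚ)) ⟩
        a₀ · (λ _ → 0ℚ) - (a₀ · (λ _ → 0ℚ) - γ * q)
          ≡⟨ cong₂ _-_ (Σ-0 (λ x → *-zeroʳ (a₀ x)))
               (trans (sym (·-sub a₀ (λ _ → 0ℚ) a₀ γ))
               (trans (·-congʳ a₀ (λ x → sym (comb-perps≡ x))) (a₀·comb-perps gs))) ⟩
        0ℚ - 0ℚ                                   ≡⟨⟩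
        0ℚ                                        ∎
        where
        lemma : ∀ q γ t → q * γ ≡ t - (t - γ * q)
        lemma = solve-∀ ringℚ

      γ≡0 : γ ≡ 0ℚ
      γ≡0 = *-cancelˡ-0 q≢0 qγ≡0

      gs≡0 : ∀ j → gs j ≡ 0ℚ
      gs≡0 = independent new gs (λ j → supp (suc j)) λ x →
        trans (comb-perps≡ x) (trans (cong (λ t → 0ℚ - t * a₀ x) γ≡0) (lemma (a₀ x)))
        where
        lemma : ∀ a → 0ℚ - 0ℚ * a ≡ 0ℚ
        lemma = solve-∀ ringℚ

      g₀≡0 : g zero ≡ 0ℚ
      g₀≡0 = begin
        g zero        ≡⟨ +-identityʳ (g zero) ⟨
        g zero + 0ℚ   ≡⟨ cong (g zero +_) (sym (Σ-0 (λ j →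
                            trans (cong (_* along (as (suc j))) (gs≡0 j)) (*-zeroˡ (along (as (suc j))))))) ⟩
        γ             ≡⟨ γ≡0 ⟩
        0ℚ            ∎

    result : Projection as b
    result = record
      { coeff = s ∷ᶠ f ; residual = z
      ; 0≤coeff = λ { zero → 0≤s ; (suc j) → 0≤coeff new j }
      ; decomposition = decomp ; dual = dual′
      ; complementary = complementary′ ; independent = independent′ }

  -- Generators are added one at a time. If the residual for the others is nonpositive on the new
  -- generator, weight 0 preserves every condition; otherwise the new generator is exchanged in.
  project : ∀ {N k} (as : Fin k → Vector N) (b : Vector N) → Projection as b
  project {k = zero} as b = record
    { coeff = λ () ; residual = b ; 0≤coeff = λ () ; decomposition = λ x → sym (+-identityʳ (b x))
    ; dual = λ () ; complementary = λ () ; independent = λ _ _ _ () }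
  project {k = suc k} as b with project (as ∘ suc) b
  ... | old with residual old · as zero ≤? 0ℚ
  ...   | no  ζ≰0 = Exchange.result as b old (≰⇒> ζ≰0) project
  ...   | yes ζ≤0 = record
    { coeff = 0ℚ ∷ᶠ coeff old
    ; residual = residual old
    ; 0≤coeff = λ { zero → ≤-refl ; (suc j) → 0≤coeff old j }
    ; decomposition = λ x → trans (decomposition old x)
        (cong (residual old x +_) (sym (drop-zero (as zero x) _)))
    ; dual = λ { zero → ζ≤0 ; (suc j) → dual old j }
    ; complementary = λ { zero → *-zeroˡ (residual old · as zero) ; (suc j) → complementary old j }
    ; independent = λ g supp g-dep → λ where
        zero    → supp zero refl
        (suc j) → independent old (g ∘ suc) (λ j → supp (suc j)) (λ x → begin
          comb (as ∘ suc) (g ∘ suc) x  ≡⟨ drop-zero (as zero x) _ ⟨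
          0ℚ * as zero x + comb (as ∘ suc) (g ∘ suc) x
            ≡⟨ cong (λ t → t * as zero x + comb (as ∘ suc) (g ∘ suc) x) (sym (supp zero refl)) ⟩
          comb as g x                  ≡⟨ g-dep x ⟩
          0ℚ                           ∎) j }
    where
    open ≡-Reasoning
    drop-zero : ∀ a t → 0ℚ * a + t ≡ t
    drop-zero = solve-∀ ringℚ

open ConicProjection
open Projection

-- Homogeneous linear systems, minimal transversals and counting by weights.

module FiniteCounting where
  open import Data.Rational hiding (floor)
  open import Data.Rational.Properties
  open import Data.List.Extrema (DecTotalOrder.totalOrder ≤-decTotalOrder)
    using (argmin; argmin-all; f[argmin]≤f[xs])

  -- The pivot search of Gaussian elimination. The last component stands in for a permutation: it
  -- lets a property shown for the pivot and the remaining rows be read off for `rows`.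
  extract-nonzero : ∀ {m} (rows : List (Vector (suc m))) →
    All (λ ρ → ρ zero ≡ 0ℚ) rows ⊎
    ∃₂ λ ρ rest → ρ zero ≢ 0ℚ × length rows ≡ suc (length rest) ×
      (∀ (P : Vector (suc m) → Set) → P ρ → All P rest → All P rows)
  extract-nonzero [] = inj₁ []
  extract-nonzero (ρ ∷ rows) with ρ zero ≟ 0ℚ
  ... | no  ρ₀≢0 = inj₂ (ρ , rows , ρ₀≢0 , refl , λ _ → _∷_)
  ... | yes ρ₀≡0 with extract-nonzero rows
  ...   | inj₁ all0 = inj₁ (ρ₀≡0 ∷ all0)
  ...   | inj₂ (σ , rest , σ₀≢0 , len , reinsert) =
    inj₂ (σ , ρ ∷ rest , σ₀≢0 , cong suc len , λ { P Pσ (Pρ ∷ Prest) → Pρ ∷ reinsert P Pσ Prest })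

  -- Induction on the unknowns. If the first unknown occurs in no row, its unit vector is a
  -- solution; otherwise a pivot row eliminates one unknown together with one equation.
  underdetermined : ∀ {m} (rows : List (Vector m)) → length rows ℕ.< m →
    ∃ λ (g : Vector m) → (∃ λ j → g j ≢ 0ℚ) × All (λ ρ → ρ · g ≡ 0ℚ) rows
  underdetermined {suc m} rows len< with extract-nonzero rows
  ... | inj₁ all0 = (1ℚ ∷ᶠ λ _ → 0ℚ) , (zero , λ ()) , All.map (λ {ρ} → column ρ) all0
    where
    column : ∀ (ρ : Vector (suc m)) → ρ zero ≡ 0ℚ → ρ · (1ℚ ∷ᶠ λ _ → 0ℚ) ≡ 0ℚ
    column ρ ρ₀≡0 = trans (cong₂ _+_ (trans (*-identityʳ (ρ zero)) ρ₀≡0)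
      (Σ-0 (λ j → *-zeroʳ (ρ (suc j))))) (+-identityʳ 0ℚ)
  ... | inj₂ (π , rest , π₀≢0 , len , reinsert) = solve (underdetermined (map eliminate rest)
          (subst (ℕ._< m) (sym (length-map eliminate rest)) (ℕ.s≤s⁻¹ (subst (ℕ._< suc m) len len<))))
    where
    open ≡-Reasoning
    instance _ = ≢-nonZero π₀≢0
    i : ℚ
    i = 1/ (π zero)

    eliminate : Vector (suc m) → Vector m
    eliminate ρ j = ρ (suc j) - ρ zero * i * π (suc j)

    module _ (g : Vector m) where
      t : ℚ
      t = (π ∘ suc) · g

      extend : Vector (suc m)
      -- The value of the first unknown is the one that solves the pivot equation.
      extend = - (i * t) ∷ᶠ g

      pivot-row : π · extend ≡ 0ℚ
      pivot-row = begin
        π zero * - (i * t) + t   ≡⟨ lemma₁ (π zero) i t ⟩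
        t - i * π zero * t       ≡⟨ cong (λ c → t - c * t) (*-inverseˡ (π zero)) ⟩
        t - 1ℚ * t               ≡⟨ lemma₂ t ⟩
        0ℚ                       ∎
        where
        lemma₁ : ∀ p i t → p * - (i * t) + t ≡ t - i * p * t
        lemma₁ = solve-∀ ringℚ
        lemma₂ : ∀ t → t - 1ℚ * t ≡ 0ℚ
        lemma₂ = solve-∀ ringℚ

      other-row : ∀ {ρ} → eliminate ρ · g ≡ 0ℚ → ρ · extend ≡ 0ℚ
      other-row {ρ} eq = begin
        ρ zero * - (i * t) + (ρ ∘ suc) · g    ≡⟨ lemma (ρ zero) i t _ ⟩
        (ρ ∘ suc) · g - ρ zero * i * t
          ≡⟨ cong₂ (λ a b → a - ρ zero * i * b) (·-comm (ρ ∘ suc) g) (·-comm (π ∘ suc) g) ⟩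
        g · (ρ ∘ suc) - ρ zero * i * (g · (π ∘ suc))
          ≡⟨ ·-sub g (ρ ∘ suc) (π ∘ suc) (ρ zero * i) ⟨
        g · eliminate ρ                       ≡⟨ ·-comm g (eliminate ρ) ⟩
        eliminate ρ · g                       ≡⟨ eq ⟩
        0ℚ                                    ∎
        where
        lemma : ∀ r i t s → r * - (i * t) + s ≡ s - r * i * t
        lemma = solve-∀ ringℚ

    solve : (∃ λ (g : Vector m) → (∃ λ j → g j ≢ 0ℚ) × All (λ ρ → ρ · g ≡ 0ℚ) (map eliminate rest)) →
            ∃ λ (g : Vector (suc m)) → (∃ λ j → g j ≢ 0ℚ) × All (λ ρ → ρ · g ≡ 0ℚ) rows
    solve (g , (j , gj≢0) , eqs) = extend g , (suc j , gj≢0) ,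
      reinsert _ (pivot-row g) (All.map (λ {ρ} → other-row g {ρ}) (map⁻ eqs))

  -- Minimise in two stages: for each first element take a best tail, then choose the best first
  -- element.
  minimal-transversal : ∀ {A : Set} {m} (E : Fin m → List A) → (∀ i → ∃ (_∈ E i)) →
    (φ : Vec A m → ℚ) →
    ∃ λ R → (∀ i → lookup R i ∈ E i) × (∀ R′ → (∀ i → lookup R′ i ∈ E i) → φ R ≤ φ R′)
  minimal-transversal {m = zero}  E nonempty φ = [] , (λ ()) , λ { [] _ → ≤-refl }
  minimal-transversal {A} {suc m} E nonempty φ = first ∷ tail first , R∈E , minimal
    where
    best : ∀ x → _
    best x = minimal-transversal (E ∘ suc) (nonempty ∘ suc) (λ R → φ (x ∷ R))

    tail : A → Vec A m
    tail x = proj₁ (best x)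

    ψ : A → ℚ
    ψ x = φ (x ∷ tail x)

    first : A
    -- The default value of `argmin` competes with the list, so it has to be a member of `E zero`
    -- itself.
    first = argmin ψ (proj₁ (nonempty zero)) (E zero)

    R∈E : ∀ i → lookup (first ∷ tail first) i ∈ E i
    R∈E zero    = argmin-all ψ (proj₂ (nonempty zero)) (All.tabulate λ x∈ → x∈)
    R∈E (suc i) = proj₁ (proj₂ (best first)) i

    minimal : ∀ R′ → (∀ i → lookup R′ i ∈ E i) → ψ first ≤ φ R′
    minimal (x ∷ R′) R′∈E = ≤-trans
      (All.lookup (f[argmin]≤f[xs] {f = ψ} (proj₁ (nonempty zero)) (E zero)) (R′∈E zero))
      (proj₂ (proj₂ (best x)) R′ (R′∈E ∘ suc))

  -- The division by 1 is normalised through a gcd that is stuck for a variable `n`; the explicit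
  -- normal form lets sums and comparisons compute.
  ℕ→ℚ≡mkℚ : ∀ n → ℕ→ℚ n ≡ mkℚ (ℤ.+ n) 0 (Coprimality.sym (Coprimality.1-coprimeTo n))
  ℕ→ℚ≡mkℚ n = normalize-coprime (Coprimality.sym (Coprimality.1-coprimeTo n))

  ℕ→ℚ-suc : ∀ n → ℕ→ℚ (suc n) ≡ 1ℚ + ℕ→ℚ n
  ℕ→ℚ-suc n = trans (/-cong {q₁ = 1} numerators refl) (cong (1ℚ +_) (sym (ℕ→ℚ≡mkℚ n)))
    where
    numerators : ℤ.+ suc n ≡ ℤ.+ 1 ℤ.* ℤ.+ 1 ℤ.+ ℤ.+ n ℤ.* ℤ.+ 1
    numerators = cong (ℤ._+_ (ℤ.+ 1)) (sym (ℤ.*-identityʳ (ℤ.+ n)))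

  ℕ→ℚ-cancel-< : ∀ {m n} → ℕ→ℚ m < ℕ→ℚ n → m ℕ.< n
  ℕ→ℚ-cancel-< {m} {n} m<n
    with *<* lt ← subst₂ _<_ (ℕ→ℚ≡mkℚ m) (ℕ→ℚ≡mkℚ n) m<n =
    ℤ.drop‿+<+ (subst₂ ℤ._<_ (ℤ.*-identityʳ (ℤ.+ m)) (ℤ.*-identityʳ (ℤ.+ n)) lt)

  -- Each listed index accounts for at least 1 of the sum. The list holds images under `h`, which
  -- are unaffected when the induction shifts the index.
  few-heavy : ∀ {X : Set} {M} (h : Fin M → X) {Q : X → Set} → Decidable Q → (g : Fin M → ℚ) →
    (∀ a → 0ℚ ≤ g a) → (∀ a → Q (h a) → 1ℚ ≤ g a) →
    ∃ λ L → (∀ a → Q (h a) → h a ∈ L) × ℕ→ℚ (length L) ≤ sumFin M g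
  few-heavy {M = zero}  h Q? g 0≤g 1≤g = [] , (λ ()) , ≤-refl
  few-heavy {M = suc M} h Q? g 0≤g 1≤g
    with few-heavy (h ∘ suc) Q? (g ∘ suc) (0≤g ∘ suc) (1≤g ∘ suc) | Q? (h zero)
  ... | L , covers , len | no ¬q = L , (λ { zero q → contradiction q ¬q ; (suc a) q → covers a q }) ,
    subst (_≤ _) (+-identityˡ _) (+-mono-≤ (0≤g zero) len)
  ... | L , covers , len | yes q = h zero ∷ L , (λ { zero _ → here refl ; (suc a) q → there (covers a q) }) ,
    subst (_≤ _) (sym (ℕ→ℚ-suc (length L))) (+-mono-≤ (1≤g zero q) len)

  concat-covers : ∀ {X : Set} {r} (N : ℕ) (P : Fin r → X → Set) →
    (∀ i → ∃ λ L → (∀ x → P i x → x ∈ L) × length L ℕ.≤ N) →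
    ∃ λ L → (∀ i x → P i x → x ∈ L) × length L ℕ.≤ r ℕ.* N
  concat-covers {r = zero}  N P lists = [] , (λ ()) , ℕ.z≤n
  concat-covers {r = suc r} N P lists
    with lists zero | concat-covers N (P ∘ suc) (lists ∘ suc)
  ... | L₀ , covers₀ , len₀ | L , covers , len = L₀ ++ L ,
    (λ { zero x px → ∈-++⁺ˡ (covers₀ x px) ; (suc i) x px → ∈-++⁺ʳ L₀ (covers i x px) }) ,
    subst (ℕ._≤ N ℕ.+ r ℕ.* N) (sym (length-++ L₀)) (ℕ.+-mono-≤ len₀ len)

  0≤ℕ→ℚ : ∀ n → 0ℚ ≤ ℕ→ℚ n
  0≤ℕ→ℚ zero    = ≤-refl
  0≤ℕ→ℚ (suc n) = subst (0ℚ ≤_) (sym (ℕ→ℚ-suc n)) (0≤+ (nonNegative⁻¹ 1ℚ) (0≤ℕ→ℚ n))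

open FiniteCounting

-- The hypergraph as a cone, heavy vertices and the exchange of an edge.

module Hypergraph where
  open import Data.Rational hiding (floor)
  open import Data.Rational.Properties

  ≤Σ : ∀ {k} (g : Fin k → ℕ) → ∃ λ M → ∀ j → g j ℕ.≤ M
  ≤Σ {zero}  g = 0 , λ ()
  ≤Σ {suc k} g with ≤Σ (g ∘ suc)
  ... | M , g≤M = g zero ℕ.+ M , λ where
    zero    → ℕ.m≤m+n (g zero) M
    (suc j) → ℕ.≤-trans (g≤M j) (ℕ.m≤n+m M (g zero))

  labels-bounded : ∀ {r m} (E : Fin m → EdgeSet r) →
    ∃ λ M → ∀ i e → e ∈ E i → ∀ part → lookup e part ℕ.< M
  labels-bounded {r} {m} E = suc (proj₁ bound) , λ i e e∈ part → s≤s (bounded i e e∈ part)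
    where
    edge-bound : ∀ i p → ∃ λ M → ∀ part → lookup (List.lookup (E i) p) part ℕ.≤ M
    edge-bound i p = ≤Σ (lookup (List.lookup (E i) p))

    set-bound : ∀ i → ∃ λ M → ∀ p → proj₁ (edge-bound i p) ℕ.≤ M
    set-bound i = ≤Σ (λ p → proj₁ (edge-bound i p))

    bound : ∃ λ M → ∀ i → proj₁ (set-bound i) ℕ.≤ M
    bound = ≤Σ (λ i → proj₁ (set-bound i))

    bounded : ∀ i e → e ∈ E i → ∀ part → lookup e part ℕ.≤ proj₁ bound
    bounded i e e∈ part = subst (λ e → lookup e part ℕ.≤ proj₁ bound) (sym (lookup-index e∈))
      (ℕ.≤-trans (proj₂ (edge-bound i p) part)
        (ℕ.≤-trans (proj₂ (set-bound i) p) (proj₂ bound i)))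
      where p = Any.index e∈

  module Geometry (r n M : ℕ) where

    vertices : ℕ
    vertices = r ℕ.* M

    indicator : Edge r → Fin r → ℕ → ℚ
    indicator e i a = if ⌊ lookup e i ℕ.≟ a ⌋ then 1ℚ else 0ℚ

    incidence : Edge r → Vector vertices
    incidence e v = indicator e (proj₁ (remQuot M v)) (toℕ (proj₂ (remQuot {r} M v)))

    -- Coordinate 0 of a vector measures the size, coordinate suc v the load at v.
    edge : Edge r → Vector (suc vertices)
    edge e = 1ℚ ∷ᶠ incidence e

    slack : Fin vertices → Vector (suc vertices)
    slack v = 0ℚ ∷ᶠ δ v

    target : Vector (suc vertices)
    target = ℕ→ℚ n ∷ᶠ λ _ → 1ℚ

    incidence-combine : ∀ e i a → incidence e (combine i a) ≡ indicator e i (toℕ a)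
    incidence-combine e i a = cong (λ v → indicator e (proj₁ v) (toℕ (proj₂ v))) (remQuot-combine i a)

    load≡ : ∀ {k} (es : Fin k → Edge r) f i a →
            load es f i a ≡ sumFin k (λ j → f j * indicator (es j) i a)
    load≡ es f i a = Σ-cong (λ j → scale (f j) ⌊ lookup (es j) i ℕ.≟ a ⌋)
      where
      scale : ∀ c b → (if b then c else 0ℚ) ≡ c * (if b then 1ℚ else 0ℚ)
      scale c true  = sym (*-identityʳ c)
      scale c false = sym (*-zeroʳ c)

    comb-edge-size : ∀ {k} (es : Fin k → Edge r) f → comb (edge ∘ es) f zero ≡ size f
    comb-edge-size es f = Σ-cong (λ j → *-identityʳ (f j))

    comb-edge-load : ∀ {k} (es : Fin k → Edge r) f i a →
                     comb (edge ∘ es) f (suc (combine i a)) ≡ load es f i (toℕ a)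
    comb-edge-load es f i a = trans
      (Σ-cong (λ j → cong (f j *_) (incidence-combine (es j) i a))) (sym (load≡ es f i (toℕ a)))

    comb-edge-vertex : ∀ {k} (es : Fin k → Edge r) f v → ∃₂ λ i a →
                       comb (edge ∘ es) f (suc v) ≡ load es f i a
    comb-edge-vertex es f v = _ , _ , sym (load≡ es f _ _)

    comb-slack-size : ∀ s → comb slack s zero ≡ 0ℚ
    comb-slack-size s = Σ-0 (λ v → *-zeroʳ (s v))

    comb-slack-vertex : ∀ s v → comb slack s (suc v) ≡ s v
    comb-slack-vertex s v = Σ-δ s v

    ·-slack : ∀ z v → z · slack v ≡ z (suc v)
    ·-slack z v = trans (cong₂ _+_ (*-zeroʳ (z zero))
        (trans (Σ-cong (λ w → cong (z (suc w) *_) (δ-sym v w))) (Σ-δ (z ∘ suc) v)))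
      (+-identityˡ (z (suc v)))

    generators : ∀ {m} → (Fin m → Edge r) → Fin (vertices ℕ.+ m) → Vector (suc vertices)
    generators es = slack ++ᶠ (edge ∘ es)

    generators-slack : ∀ {m} (es : Fin m → Edge r) v → generators es (v ↑ˡ m) ≡ slack v
    generators-slack es = lookup-++ˡ slack (edge ∘ es)

    generators-edge : ∀ {m} (es : Fin m → Edge r) j → generators es (vertices ↑ʳ j) ≡ edge (es j)
    generators-edge es = lookup-++ʳ slack (edge ∘ es)

    comb-generators : ∀ {m} (es : Fin m → Edge r) c x → comb (generators es) c x ≡
      comb slack (λ v → c (v ↑ˡ m)) x + comb (edge ∘ es) (λ j → c (vertices ↑ʳ j)) x
    comb-generators {m} es c x = trans (Σ-↑ vertices (λ j → c j * generators es j x))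
      (cong₂ _+_ (Σ-cong (λ v → cong (λ u → c (v ↑ˡ m) * u x) (generators-slack es v)))
                 (Σ-cong (λ j → cong (λ u → c (vertices ↑ʳ j) * u x) (generators-edge es j))))

    comb-generators-++ : ∀ {m} (es : Fin m → Edge r) s g x → comb (generators es) (s ++ᶠ g) x ≡
      comb slack s x + comb (edge ∘ es) g x
    comb-generators-++ es s g x = trans (comb-generators es (s ++ᶠ g) x)
      (cong₂ _+_ (Σ-cong (λ v → cong (_* slack v x) (lookup-++ˡ s g v)))
                 (Σ-cong (λ j → cong (_* edge (es j) x) (lookup-++ʳ s g j))))

    module Fit {m} (es : Fin m → Edge r) where

      π : Projection (generators es) target
      π = project (generators es) target

      z : Vector (suc vertices)
      z = residual π

      s : Fin vertices → ℚ
      s v = coeff π (v ↑ˡ m)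

      f : Fin m → ℚ
      f j = coeff π (vertices ↑ʳ j)

      0≤s : ∀ v → 0ℚ ≤ s v
      0≤s v = 0≤coeff π (v ↑ˡ m)

      0≤f : ∀ j → 0ℚ ≤ f j
      0≤f j = 0≤coeff π (vertices ↑ʳ j)

      size-equation : ℕ→ℚ n ≡ z zero + size f
      size-equation = trans (decomposition π zero) (cong (z zero +_)
        (trans (comb-generators es (coeff π) zero)
        (trans (cong₂ _+_ (comb-slack-size s) (comb-edge-size es f)) (+-identityˡ (size f)))))

      vertex-equation : ∀ v → 1ℚ ≡ z (suc v) + (s v + comb (edge ∘ es) f (suc v))
      vertex-equation v = trans (decomposition π (suc v)) (cong (z (suc v) +_)
        (trans (comb-generators es (coeff π) (suc v))
               (cong (_+ comb (edge ∘ es) f (suc v)) (comb-slack-vertex s v))))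

      z-vertex≤0 : ∀ v → z (suc v) ≤ 0ℚ
      z-vertex≤0 v = subst (_≤ 0ℚ) (trans (cong (z ·_) (generators-slack es v)) (·-slack z v))
        (dual π (v ↑ˡ m))

      sz≡0 : ∀ v → s v * z (suc v) ≡ 0ℚ
      sz≡0 v = trans (cong (s v *_) (sym (trans (cong (z ·_) (generators-slack es v)) (·-slack z v))))
        (complementary π (v ↑ˡ m))

      z·edge≤0 : ∀ j → z · edge (es j) ≤ 0ℚ
      z·edge≤0 j = subst (λ u → z · u ≤ 0ℚ) (generators-edge es j) (dual π (vertices ↑ʳ j))

      fz≡0 : ∀ j → f j * (z · edge (es j)) ≡ 0ℚ
      fz≡0 j = subst (λ u → f j * (z · u) ≡ 0ℚ) (generators-edge es j)
        (complementary π (vertices ↑ʳ j))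

      z·target≤0⇒z≡0 : z · target ≤ 0ℚ → ∀ x → z x ≡ 0ℚ
      z·target≤0⇒z≡0 zt≤0 = ·-definite z (subst (_≤ 0ℚ) (residual·target π) zt≤0)

      -- By `size-equation` the hypothesis says that `size f` is at least n. Then every coordinate
      -- of `z` is nonpositive and every coordinate of `target` nonnegative.
      size≥n⇒z≡0 : z zero ≤ 0ℚ → ∀ x → z x ≡ 0ℚ
      size≥n⇒z≡0 z₀≤0 = z·target≤0⇒z≡0 (Σ-≤0 {g = λ x → z x * target x} λ where
        zero    → subst (_≤ 0ℚ) (*-comm (ℕ→ℚ n) (z zero)) (*≤0 (0≤ℕ→ℚ n) z₀≤0)
        (suc v) → subst (_≤ 0ℚ) (sym (*-identityʳ (z (suc v)))) (z-vertex≤0 v))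

      0≤load : ∀ v → 0ℚ ≤ comb (edge ∘ es) f (suc v)
      0≤load v = Σ-≥0 (λ j → 0≤* (0≤f j) (0≤if ⌊ lookup (es j) _ ℕ.≟ _ ⌋))
        where
        0≤if : ∀ b → 0ℚ ≤ (if b then 1ℚ else 0ℚ)
        0≤if true  = nonNegative⁻¹ 1ℚ
        0≤if false = ≤-refl

      no-slack⇒heavy : ∀ v → s v ≡ 0ℚ → 1ℚ ≤ comb (edge ∘ es) f (suc v)
      no-slack⇒heavy v sv≡0 = ≤-from-diff (begin
          l                                ≡⟨ lemma l (z (suc v)) ⟩
          z (suc v) + (0ℚ + l) + - z (suc v) ≡⟨ cong (λ t → z (suc v) + (t + l) + - z (suc v)) sv≡0 ⟨
          z (suc v) + (s v + l) + - z (suc v) ≡⟨ cong (_+ - z (suc v)) (vertex-equation v) ⟨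
          1ℚ + - z (suc v)                 ∎)
        (0≤neg (z-vertex≤0 v))
        where
        open ≡-Reasoning
        l : ℚ
        l = comb (edge ∘ es) f (suc v)
        lemma : ∀ l z → l ≡ z + (0ℚ + l) + - z
        lemma = solve-∀ ringℚ

      exact-fit : (∀ j part → lookup (es j) part ℕ.< M) → (∀ x → z x ≡ 0ℚ) →
                  IsFracMatching es f × size f ≡ ℕ→ℚ n
      exact-fit label<M z≡0 = (0≤f , load≤1) , sym (trans size-equation
          (trans (cong (_+ size f) (z≡0 zero)) (+-identityˡ (size f))))
        where
        open ≡-Reasoning
        lemma : ∀ s l → 0ℚ + (s + l) ≡ l + s
        lemma = solve-∀ ringℚ

        comb≤1 : ∀ v → comb (edge ∘ es) f (suc v) ≤ 1ℚ
        comb≤1 v = ≤-from-diff (begin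
          1ℚ                                                ≡⟨ vertex-equation v ⟩
          z (suc v) + (s v + comb (edge ∘ es) f (suc v))    ≡⟨ cong (_+ (s v + comb (edge ∘ es) f (suc v))) (z≡0 (suc v)) ⟩
          0ℚ + (s v + comb (edge ∘ es) f (suc v))           ≡⟨ lemma (s v) _ ⟩
          comb (edge ∘ es) f (suc v) + s v                  ∎) (0≤s v)

        load≤1 : ∀ i a → load es f i a ≤ 1ℚ
        load≤1 i a with a ℕ.<? M
        ... | yes a<M = subst (_≤ 1ℚ)
          (trans (comb-edge-load es f i (fromℕ< a<M)) (cong (load es f i) (toℕ-fromℕ< a<M)))
          (comb≤1 (combine i (fromℕ< a<M)))
        -- A label that is at least `M` has no coordinate, but no edge of `es` uses it, so its load
        -- is 0.
        ... | no a≮M = subst (_≤ 1ℚ) (sym (Σ-0 unused)) (nonNegative⁻¹ 1ℚ)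
          where
          unused : ∀ j → (if ⌊ lookup (es j) i ℕ.≟ a ⌋ then f j else 0ℚ) ≡ 0ℚ
          unused j with lookup (es j) i ℕ.≟ a
          ... | yes refl = contradiction (label<M j i) a≮M
          ... | no  _    = refl

      -- This is where the hypergraph being r-partite enters: each edge has exactly one vertex in
      -- part `i`, so its weight is counted once.
      part-load : (∀ j part → lookup (es j) part ℕ.< M) → ∀ i →
                  sumFin M (λ a → comb (edge ∘ es) f (suc (combine i a))) ≡ size f
      part-load label<M i = begin
        sumFin M (λ a → sumFin m (λ j → f j * incidence (es j) (combine i a)))
          ≡⟨ Σ-comm (λ a j → f j * incidence (es j) (combine i a)) ⟩
        sumFin m (λ j → sumFin M (λ a → f j * incidence (es j) (combine i a)))
          ≡⟨ Σ-cong (λ j → Σ-* (f j) (λ a → incidence (es j) (combine i a))) ⟩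
        sumFin m (λ j → f j * sumFin M (λ a → incidence (es j) (combine i a)))
          ≡⟨ Σ-cong (λ j → cong (f j *_) (trans (Σ-cong (incidence-combine (es j) i))
                                                (Σ-indicator (lookup (es j) i) (label<M j i)))) ⟩
        sumFin m (λ j → f j * 1ℚ)
          ≡⟨ comb-edge-size es f ⟩
        size f ∎
        where open ≡-Reasoning

      -- A vertex without slack has load at least 1, and the loads in one part add up to `size f`,
      -- which is less than n because `z zero` is positive.
      heavy-vertices : (∀ j part → lookup (es j) part ℕ.< M) → 0ℚ < z zero →
        ∃ λ L → (∀ v → s v ≡ 0ℚ → v ∈ L) × length L ℕ.≤ r ℕ.* (n ℕ.∸ 1)
      heavy-vertices label<M 0<z₀ = proj₁ all-parts , covers , proj₂ (proj₂ all-parts)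
        where
        In : Fin r → Fin vertices → Set
        In i v = ∃ λ a → v ≡ combine i a × s v ≡ 0ℚ

        size<n : size f < ℕ→ℚ n
        size<n = subst₂ _<_ (+-identityˡ (size f)) (sym size-equation) (+-monoˡ-< (size f) 0<z₀)

        part : ∀ i → ∃ λ L → (∀ v → In i v → v ∈ L) × length L ℕ.≤ n ℕ.∸ 1
        part i = L , (λ { v (a , refl , sv≡0) → covers a sv≡0 }) ,
            -- The strict bound by n holds in ℚ; moved to ℕ, it improves to n - 1.
            ℕ.∸-monoˡ-≤ 1 (ℕ→ℚ-cancel-< {length L} {n} (≤-<-trans length≤size size<n))
          where
          heavy = few-heavy (combine {r} {M} i) {λ v → s v ≡ 0ℚ} (λ v → s v ≟ 0ℚ)
                    (λ a → comb (edge ∘ es) f (suc (combine i a)))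
                    (λ a → 0≤load (combine i a)) (λ a → no-slack⇒heavy (combine i a))
          L = proj₁ heavy
          covers = proj₁ (proj₂ heavy)

          length≤size : ℕ→ℚ (length L) ≤ size f
          length≤size = subst (ℕ→ℚ (length L) ≤_) (part-load label<M i) (proj₂ (proj₂ heavy))

        all-parts : ∃ λ L → (∀ i v → In i v → v ∈ L) × length L ℕ.≤ r ℕ.* (n ℕ.∸ 1)
        all-parts = concat-covers (n ℕ.∸ 1) In part

        covers : ∀ v → s v ≡ 0ℚ → v ∈ proj₁ all-parts
        covers v sv≡0 = proj₁ (proj₂ all-parts) (proj₁ (remQuot M v)) v
          (proj₂ (remQuot {r} M v) , sym (combine-remQuot {r} M v) , sv≡0)

      -- A linear dependence among the edges on the heavy vertices extends to all
      -- coordinates: slack absorbs the light vertices, and orthogonality to z the size.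
      edges-independent : ¬ (∃ λ j → f j ≡ 0ℚ) → 0ℚ < z zero → ∀ g →
        (∀ v → s v ≡ 0ℚ → comb (edge ∘ es) g (suc v) ≡ 0ℚ) → ∀ j → g j ≡ 0ℚ
      edges-independent none 0<z₀ g dep-heavy j = trans (sym (lookup-++ʳ h g j))
          (independent π (h ++ᶠ g) support dependence (vertices ↑ʳ j))
        where
        open ≡-Reasoning

        dep : Vector (suc vertices)
        dep = comb (edge ∘ es) g

        z·edge≡0 : ∀ j → z · edge (es j) ≡ 0ℚ
        z·edge≡0 j = *-cancelˡ-0 (λ fj≡0 → none (j , fj≡0)) (fz≡0 j)

        -- At a vertex without slack the dependence vanishes by assumption; at any other vertex `z`
        -- vanishes by complementarity.
        z-dep-vertex : ∀ v → z (suc v) * dep (suc v) ≡ 0ℚ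
        z-dep-vertex v with s v ≟ 0ℚ
        ... | yes sv≡0 = trans (cong (z (suc v) *_) (dep-heavy v sv≡0)) (*-zeroʳ (z (suc v)))
        ... | no  sv≢0 = trans (cong (_* dep (suc v)) (*-cancelˡ-0 sv≢0 (sz≡0 v))) (*-zeroˡ (dep (suc v)))

        z₀dep₀≡0 : z zero * dep zero ≡ 0ℚ
        z₀dep₀≡0 = begin
          z zero * dep zero         ≡⟨ +-identityʳ (z zero * dep zero) ⟨
          z zero * dep zero + 0ℚ    ≡⟨ cong (z zero * dep zero +_) (Σ-0 z-dep-vertex) ⟨
          z · dep                   ≡⟨ ·-comb z (edge ∘ es) g ⟩
          sumFin m (λ j → g j * (z · edge (es j)))
            ≡⟨ Σ-0 (λ j → trans (cong (g j *_) (z·edge≡0 j)) (*-zeroʳ (g j))) ⟩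
          0ℚ                        ∎

        dep₀≡0 : dep zero ≡ 0ℚ
        dep₀≡0 = *-cancelˡ-0 (λ z₀≡0 → <-irrefl (sym z₀≡0) 0<z₀) z₀dep₀≡0

        h : Fin vertices → ℚ
        h v = - dep (suc v)

        dependence : ∀ x → comb (generators es) (h ++ᶠ g) x ≡ 0ℚ
        dependence zero = trans (comb-generators-++ es h g zero)
          (trans (cong₂ _+_ (comb-slack-size h) dep₀≡0) (+-identityʳ 0ℚ))
        dependence (suc v) = trans (comb-generators-++ es h g (suc v))
          (trans (cong (_+ dep (suc v)) (comb-slack-vertex h v)) (+-inverseˡ (dep (suc v))))

        -- Under `none` every edge has nonzero weight, so only the slack coordinates impose a
        -- condition.
        support : ∀ x → coeff π x ≡ 0ℚ → (h ++ᶠ g) x ≡ 0ℚ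
        support = ↑-elim
          (λ v sv≡0 → trans (lookup-++ˡ h g v) (cong -_ (dep-heavy v sv≡0)))
          (λ j fj≡0 → contradiction (j , fj≡0) none)

      -- One equation per heavy vertex, one unknown per edge: with more edges than equations there
      -- is a nonzero `g` with zero load at every heavy vertex. If all weights were nonzero,
      -- `edges-independent` would forbid it.
      unused-edge : (∀ j part → lookup (es j) part ℕ.< M) → r ℕ.* (n ℕ.∸ 1) ℕ.< m →
                    0ℚ < z zero → ∃ λ j → f j ≡ 0ℚ
      unused-edge label<M large 0<z₀ = decidable-stable (any? (λ j → f j ≟ 0ℚ)) λ none →
        let L , covers , len = heavy-vertices label<M 0<z₀
            g , (j , gj≢0) , rows = underdetermined (map (λ v j → incidence (es j) v) L)
              (ℕ.≤-<-trans (ℕ.≤-trans (ℕ.≤-reflexive (length-map _ L)) len) large)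
        in gj≢0 (edges-independent none 0<z₀ g (λ v sv≡0 →
             trans (·-comm g (λ j → incidence (es j) v)) (All.lookup (map⁻ rows) (covers v sv≡0))) j)

      -- A fractional matching `w` of size at least n gives a point `q` with first coordinate at
      -- least n and all others at most 1. The signs of `z` make z · target ≤ z · q. If no edge had
      -- positive product with `z`, then z · q ≤ 0, which would force z = 0.
      improving-edge : ∀ (E : EdgeSet r) → νStar≥ E n → 0ℚ < z zero → ∃ λ e → e ∈ E × 0ℚ < z · edge e
      improving-edge E (w , (0≤w , load≤1) , n≤size) 0<z₀
        with all? (λ p → z · edge (List.lookup E p) ≤? 0ℚ)
      ... | no  ¬all = let p , zp≰0 = ¬∀⟶∃¬ (length E) _ (λ p → z · edge (List.lookup E p) ≤? 0ℚ) ¬all in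
        List.lookup E p , ∈-lookup p , ≰⇒> zp≰0
      ... | yes all≤0 = contradiction 0<z₀ (<-irrefl (sym (z·target≤0⇒z≡0 zt≤0 zero)))
        where
        q : Vector (suc vertices)
        q = comb (edge ∘ List.lookup E) w

        q≤1 : ∀ v → q (suc v) ≤ 1ℚ
        q≤1 v = let i , a , eq = comb-edge-vertex (List.lookup E) w v in
          subst (_≤ 1ℚ) (sym eq) (load≤1 i a)

        zt≤zq : z · target ≤ z · q
        zt≤zq = Σ-mono {g = λ x → z x * target x} {λ x → z x * q x} λ where
          zero    → *-monoˡ-≤-nonNeg (z zero) {{nonNegative (<⇒≤ 0<z₀)}}
                      (subst (ℕ→ℚ n ≤_) (sym (comb-edge-size (List.lookup E) w)) n≤size)
          (suc v) → *-monoˡ-≤-nonPos (z (suc v)) {{nonPositive (z-vertex≤0 v)}} (q≤1 v)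

        zt≤0 : z · target ≤ 0ℚ
        zt≤0 = ≤-trans zt≤zq (subst (_≤ 0ℚ) (sym (·-comb z (edge ∘ List.lookup E) w))
          (Σ-≤0 (λ p → *≤0 (0≤w p) (all≤0 p))))

    -- The squared distance from `target` to the cone of `R`; squaring keeps it rational.
    φ : ∀ {m} → Vec (Edge r) m → ℚ
    φ R = Fit.z (lookup R) · Fit.z (lookup R)

    -- As edge `j` has weight 0, the old projection still lies in the new cone. If the new distance
    -- were not smaller, the residuals would agree, yet the new one is nonpositive on `e`.
    swap-decreases : ∀ {m} (R : Vec (Edge r) m) j e → Fit.f (lookup R) j ≡ 0ℚ →
      0ℚ < Fit.z (lookup R) · edge e → ¬ (φ R ≤ φ (R [ j ]≔ e))
    swap-decreases {m} R j e fj≡0 0<ze φ≤ = <⇒≱ 0<ze (subst (_≤ 0ℚ) same z′e≤0)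
      where
      module A = Fit (lookup R)
      R′ : Vec (Edge r) m
      R′ = R [ j ]≔ e
      module B = Fit (lookup R′)

      common : ∀ x → comb (generators (lookup R′)) (coeff A.π) x ≡ comb (generators (lookup R)) (coeff A.π) x
      common x = trans (comb-generators (lookup R′) (coeff A.π) x)
        (trans (cong (comb slack A.s x +_) (Σ-cong agree)) (sym (comb-generators (lookup R) (coeff A.π) x)))
        where
        agree : ∀ k → A.f k * edge (lookup R′ k) x ≡ A.f k * edge (lookup R k) x
        agree k with k Fin.≟ j
        ... | yes refl = trans (cong (_* edge (lookup R′ k) x) fj≡0)
          (trans (trans (*-zeroˡ (edge (lookup R′ k) x)) (sym (*-zeroˡ (edge (lookup R k) x))))
                 (cong (_* edge (lookup R k) x) (sym fj≡0)))
        ... | no  k≢j  = cong (λ d → A.f k * edge d x) (lookup∘update′ k≢j R e)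

      z≡z′ : ∀ x → A.z x ≡ B.z x
      z≡z′ = closest-residual-unique A.π B.π (coeff A.π) (0≤coeff A.π) common φ≤

      z′e≤0 : B.z · edge e ≤ 0ℚ
      z′e≤0 = subst (λ d → B.z · edge d ≤ 0ℚ) (lookup∘update j R e) (B.z·edge≤0 j)

      same : B.z · edge e ≡ A.z · edge e
      same = Σ-cong (λ x → cong (_* edge e x) (sym (z≡z′ x)))

    minimal⇒size≥n : ∀ {m} → r ℕ.* (n ℕ.∸ 1) ℕ.< m → (E : Fin m → EdgeSet r) →
      (∀ i → νStar≥ (E i) n) → (∀ i e → e ∈ E i → ∀ part → lookup e part ℕ.< M) →
      (R : Vec (Edge r) m) → (∀ i → lookup R i ∈ E i) →
      (∀ R′ → (∀ i → lookup R′ i ∈ E i) → φ R ≤ φ R′) → Fit.z (lookup R) zero ≤ 0ℚ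
    minimal⇒size≥n large E ν≥n label<M R R∈E minimal =
      decidable-stable (z zero ≤? 0ℚ) λ z₀≰0 →
        let 0<z₀ = ≰⇒> z₀≰0
            j , fj≡0 = unused-edge (λ i → label<M i (lookup R i) (R∈E i)) large 0<z₀
            e , e∈ , 0<ze = improving-edge (E j) (ν≥n j) 0<z₀
        in swap-decreases R j e fj≡0 0<ze (minimal (R [ j ]≔ e) (swap∈ j e e∈))
      where
      open Fit (lookup R)

      swap∈ : ∀ j e → e ∈ E j → ∀ i → lookup (R [ j ]≔ e) i ∈ E i
      swap∈ j e e∈ i with i Fin.≟ j
      ... | yes refl = subst (_∈ E i) (sym (lookup∘update i R e)) e∈
      ... | no  i≢j  = subst (_∈ E i) (sym (lookup∘update′ i≢j R e)) (R∈E i)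

  νStar≥⇒nonempty : ∀ {r n} (E : EdgeSet r) → 1 ℕ.≤ n → νStar≥ E n → ∃ (_∈ E)
  νStar≥⇒nonempty (e ∷ _) _ _ = e , here refl
  νStar≥⇒nonempty {n = suc n} [] _ (_ , _ , n≤0) = contradiction
    (≤-trans (≤-from-diff (ℕ→ℚ-suc n) (0≤ℕ→ℚ n)) n≤0) (<⇒≱ (positive⁻¹ 1ℚ))

  rainbow : ∀ {r m} n → 1 ℕ.≤ n → r ℕ.* (n ℕ.∸ 1) ℕ.< m → (E : Fin m → EdgeSet r) →
            (∀ i → νStar≥ (E i) n) → HasRainbowFracMatching E n
  rainbow {r} {m} n 1≤n large E ν≥n =
    let M , label<M = labels-bounded E
        open Geometry r n M
        R , R∈E , minimal = minimal-transversal E (λ i → νStar≥⇒nonempty (E i) 1≤n (ν≥n i)) φ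
        open Fit (lookup R)
    -- The whole transversal is used, with one edge for each index and weight 0 allowed, so `σ` is
    -- the identity.
    in m , id , lookup R , f , id ,
       (λ i → Any.index (R∈E i) , sym (lookup-index (R∈E i))) ,
       exact-fit (λ i → label<M i (lookup R i) (R∈E i))
         (size≥n⇒z≡0 (minimal⇒size≥n large E ν≥n label<M R R∈E minimal))

open Hypergraph
open import Data.Nat using (ℕ; _≤_; _*_; _∸_; _+_)

theorem7 : (r n : ℕ) → 2 ≤ r → 1 ≤ n →
    (E : Fin (r * n ∸ r + 1) → EdgeSet r) →
    ((i : Fin (r * n ∸ r + 1)) → νStar≥ (E i) n) →
    HasRainbowFracMatching E n
-- The number of sets is r(n - 1) + 1, one more than the bound on the heavy vertices.
theorem7 r n _ 1≤n = rainbow n 1≤n (ℕ.≤-reflexive (begin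
  1 + r * (n ∸ 1)      ≡⟨ ℕ.+-comm 1 (r * (n ∸ 1)) ⟩
  r * (n ∸ 1) + 1      ≡⟨ cong (_+ 1) (ℕ.*-distribˡ-∸ r n 1) ⟩
  r * n ∸ r * 1 + 1    ≡⟨ cong (λ k → r * n ∸ k + 1) (ℕ.*-identityʳ r) ⟩
  r * n ∸ r + 1        ∎))
  where open ≡-Reasoning
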